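{- For all $n\ge1$, $$P_n^{\mathsf{ddes}}(-1)=\begin{cases}E_n,&\text{if } n\text{ is odd},\\ 0,&\text{if } n\text{ is even}.\end{cases}$$ Thus $P^{\mathsf{ddes}}(-1;x)=\tan(x)$ (as formal power series in $x$).
   Context: Let $\mathfrak{S}_n$ be the set of permutations $\pi=\pi_1\cdots\pi_n$ (one-line notation) of $[n]=\{1,\dots,n\}$. Use the convention $\pi_0=\pi_{n+1}=\infty$. A letter $\pi_i$ ($1\le i\le n$) of $\pi$ is a double descent if $\pi_{i-1}>\pi_i>\pi_{i+1}$; let $\mathsf{ddes}(\pi)$ be the number of double descents of $\pi$. Define $P_n^{\mathsf{ddes}}(t)=\sum_{\pi\in\mathfrak{S}_n}t^{\mathsf{ddes}(\pi)}$ and $P^{\mathsf{ddes}}(t;x)=\sum_{n=1}^\infty P_n^{\mathsf{ddes}}(t)\frac{x^n}{n!}$. The Euler numbers $E_n$ are defined by $\sum_{n=0}^\infty E_n\frac{x^n}{n!}=\sec(x)+\tan(x)$. -}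

module Defs where

open import Data.Bool.Base using (if_then_else_)
open import Data.Fin.Base as Fin using (Fin; toℕ)
open import Data.Integer.Base as ℤ using (ℤ; +_; 0ℤ; 1ℤ)
open import Data.List.Base using (List; []; _∷_; _++_; map; foldr; filter; upTo; cartesianProductWith)
open import Data.List.Relation.Unary.Unique.DecPropositional using (unique?)
open import Data.Nat.Base as ℕ using (ℕ; zero; suc; _∸_; _!)
open import Data.Nat.Properties as ℕ using (_!≢0)
open import Data.Rational.Base as ℚ using (ℚ; 0ℚ; 1ℚ; _/_; 1/_)
open import Data.Rational.Properties as ℚ using (+-0-monoid)
open import Data.Vec.Functional as Vector using (Vector)
open import Relation.Binary.PropositionalEquality.Core using (_≡_; refl; sym; trans; cong; cong₂)
open import Relation.Binary.PropositionalEquality.Properties using (module ≡-Reasoning)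
open import Relation.Nullary.Construct.Add.Supremum using (_⁺; [_]; ⊤⁺)
open import Relation.Nullary.Decidable.Core using (Dec; does; _×-dec_)
open import Algebra.Properties.Monoid.Sum +-0-monoid using (sum⁺-syntax; sum-cong-≗)
import Relation.Binary.Construct.Add.Supremum.Strict as Supremum

------------------------------------------------------------------------
-- Permutations and double descents

[1⋯_] : ℕ → List ℕ
[1⋯ n ] = map suc (upTo n)

words : List ℕ → ℕ → List (List ℕ)
words as zero    = [] ∷ []
words as (suc m) = cartesianProductWith _∷_ as (words as m)

-- One-line notations: the words of length n over [n] without repeated letters.
𝔖 : ℕ → List (List ℕ)
𝔖 n = filter (unique? ℕ._≟_) (words [1⋯ n ] n)

open Supremum ℕ._<_ using (_<⁺_; <⁺-dec)

_<⁺?_ : (a b : ℕ ⁺) → Dec (a <⁺ b)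
_<⁺?_ = <⁺-dec ℕ._<?_

-- The sequence π₀ π₁ ⋯ πₙ πₙ₊₁ with π₀ = πₙ₊₁ = ∞.
pad : List ℕ → List (ℕ ⁺)
pad π = ⊤⁺ ∷ map [_] π ++ ⊤⁺ ∷ []

-- Number of consecutive triples a > b > c.  In pad π, the middle entries of
-- the consecutive triples are exactly the letters of π, one for each index i
-- with 1 ≤ i ≤ n.
descentTriples : List (ℕ ⁺) → ℕ
descentTriples (a ∷ b ∷ c ∷ s) =
  (if does ((b <⁺? a) ×-dec (c <⁺? b)) then 1 else 0) ℕ.+ descentTriples (b ∷ c ∷ s)
descentTriples _ = 0

ddes : List ℕ → ℕ
ddes π = descentTriples (pad π)

P : ℕ → ℤ → ℤ
P n t = foldr ℤ._+_ 0ℤ (map (λ π → t ℤ.^ ddes π) (𝔖 n))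

------------------------------------------------------------------------
-- Formal power series over ℚ, as coefficient sequences

PowerSeries : Set
PowerSeries = ℕ → ℚ

infix  4 _≈_
infixl 6 _⊕_
infixl 7 _⊛_

_≈_ : PowerSeries → PowerSeries → Set
f ≈ g = ∀ n → f n ≡ g n

one : PowerSeries
one zero    = 1ℚ
one (suc _) = 0ℚ

_⊕_ : PowerSeries → PowerSeries → PowerSeries
(f ⊕ g) n = f n ℚ.+ g n

_⊛_ : PowerSeries → PowerSeries → PowerSeries
(f ⊛ g) n = ∑[ i ≤ n ] (f (toℕ i) ℚ.* g (n ∸ toℕ i))

-- The coefficients g n , … , g 0 (in this order) of the reciprocal g of f,
-- from f 0 * g (n + 1) = - ∑ᵢ f (i + 1) * g (n - i).
reciprocalPrefix : (f : PowerSeries) .{{_ : ℚ.NonZero (f 0)}} → ∀ n → Vector ℚ (suc n)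
reciprocalPrefix f zero    = (1/ f 0) Vector.∷ Vector.[]
reciprocalPrefix f (suc n) =
  (1/ f 0 ℚ.* (ℚ.- (∑[ i ≤ n ] (f (suc (toℕ i)) ℚ.* reciprocalPrefix f n i))))
  Vector.∷ reciprocalPrefix f n

reciprocal : (f : PowerSeries) .{{_ : ℚ.NonZero (f 0)}} → PowerSeries
reciprocal f n = reciprocalPrefix f n Fin.zero

reciprocalPrefix-lookup : ∀ f .{{_ : ℚ.NonZero (f 0)}} n i →
                          reciprocalPrefix f n i ≡ reciprocal f (n ∸ toℕ i)
reciprocalPrefix-lookup f n       Fin.zero    = refl
reciprocalPrefix-lookup f (suc n) (Fin.suc i) = reciprocalPrefix-lookup f n i

reciprocal-inverseʳ : ∀ f .{{_ : ℚ.NonZero (f 0)}} → f ⊛ reciprocal f ≈ one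
reciprocal-inverseʳ f zero    = trans (ℚ.+-identityʳ _) (ℚ.*-inverseʳ (f 0))
reciprocal-inverseʳ f (suc n) = begin
  f 0 ℚ.* (1/ f 0 ℚ.* (ℚ.- S)) ℚ.+ S′  ≡⟨ cong₂ ℚ._+_ (sym (ℚ.*-assoc (f 0) (1/ f 0) (ℚ.- S))) (sym S≡S′) ⟩
  f 0 ℚ.* 1/ f 0 ℚ.* (ℚ.- S) ℚ.+ S     ≡⟨ cong (λ q → q ℚ.* (ℚ.- S) ℚ.+ S) (ℚ.*-inverseʳ (f 0)) ⟩
  1ℚ ℚ.* (ℚ.- S) ℚ.+ S                 ≡⟨ cong (ℚ._+ S) (ℚ.*-identityˡ (ℚ.- S)) ⟩
  (ℚ.- S) ℚ.+ S                        ≡⟨ ℚ.+-inverseˡ S ⟩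
  0ℚ                                   ∎
  where
  open ≡-Reasoning
  S S′ : ℚ
  S  = ∑[ i ≤ n ] (f (suc (toℕ i)) ℚ.* reciprocalPrefix f n i)
  S′ = ∑[ i ≤ n ] (f (suc (toℕ i)) ℚ.* reciprocal f (n ∸ toℕ i))
  S≡S′ : S ≡ S′
  S≡S′ = sum-cong-≗ (λ i → cong (f (suc (toℕ i)) ℚ.*_) (reciprocalPrefix-lookup f n i))

-- Exponential generating function ∑ₙ a n xⁿ / n!.
egf : (ℕ → ℤ) → PowerSeries
egf a n = (a n / n !) {{n !≢0}}

sin-coeff cos-coeff : ℕ → ℤ

sin-coeff 0             = 0ℤ
sin-coeff 1             = 1ℤ
sin-coeff (suc (suc n)) = ℤ.- sin-coeff n

cos-coeff 0             = 1ℤ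
cos-coeff 1             = 0ℤ
cos-coeff (suc (suc n)) = ℤ.- cos-coeff n

sin cos sec tan : PowerSeries
sin = egf sin-coeff
cos = egf cos-coeff
sec = reciprocal cos
tan = sin ⊛ sec

-- Euler numbers: E n / n! is the coefficient of xⁿ in sec x + tan x.
E : ℕ → ℚ
E n = (+ (n !) / 1) ℚ.* (sec ⊕ tan) n

P-coeff : ℤ → ℕ → ℤ
P-coeff t zero    = 0ℤ
P-coeff t (suc n) = P (suc n) t

-- P(t; x) = ∑_{n ≥ 1} Pₙ(t) xⁿ / n!; the sum starts at n = 1.
Pˢ : ℤ → PowerSeries
Pˢ t = egf (P-coeff t)

{-# OPTIONS --safe #-}

-- In a permutation bordered by ∞ on both sides, give a valley the weight
-- q = 1 + tan²x, a peak 1, a double ascent s = tan x + 1 and a double descent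
-- t = tan x - 1, and let the weight of the permutation be the product over its
-- letters.  Since q′ = (s + t) q and s′ = t′ = q, the weights of all the
-- permutations obtained from π by inserting a new maximum add up to the
-- derivative of the weight of π, for nonempty π.  So the total weight of 𝔖 n,
-- n ≥ 1, is the n-th derivative of tan x, and at x = 0, where q = s = 1 and
-- t = -1, the weight of π is (-1) ^ ddes π.
module Submission where

open import Defs
open import Algebra.Bundles using (CommutativeRing)
import Algebra.Construct.Pointwise as Pointwise
open import Algebra.Properties.Monoid.Sum using (sum-cong-≗)
import Algebra.Properties.Ring as RingProperties
import Algebra.Solver.Ring.NaturalCoefficients.Default as NaturalSolver
open import Data.Bool.Base using (Bool; true; false; _∧_; if_then_else_)
open import Data.Fin.Base using (toℕ)
open import Data.Integer.Base as ℤ using (+_; 0ℤ; 1ℤ; -1ℤ)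
import Data.Integer.Properties as ℤ
open import Data.List.Base using (List; []; _∷_; _++_; map; foldr; filter; length; upTo; concatMap)
open import Data.List.Membership.DecPropositional using (_∈?_)
open import Data.List.Membership.Propositional using (_∈_; find; lose)
open import Data.List.Membership.Propositional.Properties using (∈-map⁺; ∈-map⁻; ∈-++⁺ˡ; ∈-++⁺ʳ; ∈-++⁻; ∈-∃++; ∈-concatMap⁺; ∈-concatMap⁻; ∈-cartesianProductWith⁺; ∈-cartesianProductWith⁻; ∈-filter⁺; ∈-filter⁻; ∈-upTo⁻)
open import Data.List.Membership.Propositional.Properties.WithK using (unique∧set⇒bag)
import Data.List.Properties as List
open import Data.List.Relation.Binary.BagAndSetEquality using (∼bag⇒↭)
open import Data.List.Relation.Binary.Disjoint.Propositional using (Disjoint)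
open import Data.List.Relation.Binary.Permutation.Propositional as ↭ using (_↭_; ↭⇒↭ₛ)
open import Data.List.Relation.Binary.Permutation.Propositional.Properties using (∈-resp-↭; All-resp-↭; ↭-length; shift)
import Data.List.Relation.Binary.Permutation.Setoid.Properties as Permutationₛ
open import Data.List.Relation.Unary.All as All using (All; []; _∷_)
open import Data.List.Relation.Unary.AllPairs using ([]; _∷_)
open import Data.List.Relation.Unary.Any using (here; there)
open import Data.List.Relation.Unary.Unique.DecPropositional using (unique?)
open import Data.List.Relation.Unary.Unique.Propositional using (Unique)
open import Data.List.Relation.Unary.Unique.Propositional.Properties using (map⁺; ++⁺; cartesianProductWith⁺; filter⁺; upTo⁺)
open import Data.Nat.Base as ℕ using (ℕ; zero; suc; _≤_; _<_; parity; _∸_; _!)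
open import Data.Nat.Properties as ℕ using (_!≢0)
open import Data.Parity.Base using (0ℙ; 1ℙ)
open import Data.Product.Base using (_×_; _,_; proj₁; proj₂)
open import Data.Rational.Base as ℚ using (ℚ; 0ℚ; 1ℚ; _/_)
import Data.Rational.Properties as ℚ
import Data.Rational.Solver as ℚSolver
open import Data.Rational.Unnormalised.Base as ℚᵘ using (mkℚᵘ; *≡*)
import Data.Rational.Unnormalised.Properties as ℚᵘ
open import Data.Sum.Base using (inj₁; inj₂)
open import Function.Base using (_∘_; _$_)
open import Function.Bundles using (mk⇔)
open import Level using (0ℓ)
open import Relation.Binary.PropositionalEquality using (_≡_; _≢_; refl; sym; trans; cong; cong₂; subst; subst₂; setoid; module ≡-Reasoning)
import Relation.Binary.Reasoning.Setoid as SetoidReasoning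
open import Relation.Nullary.Construct.Add.Supremum using (⊤⁺; [_])
open import Relation.Nullary.Decidable using (does; yes; no; ¬?; dec-true; dec-false)
open import Relation.Nullary.Negation using (contradiction)

-- Fractions

/1-homo-+ : ∀ i j → (i / 1) ℚ.+ (j / 1) ≡ (i ℤ.+ j) / 1
/1-homo-+ i j = ℚ.toℚᵘ-injective $ begin-equality
  ℚ.toℚᵘ (i / 1 ℚ.+ j / 1)            ≃⟨ ℚ.toℚᵘ-homo-+ (i / 1) (j / 1) ⟩
  ℚ.toℚᵘ (i / 1) ℚᵘ.+ ℚ.toℚᵘ (j / 1)  ≃⟨ ℚᵘ.+-cong (ℚ.toℚᵘ-fromℚᵘ (mkℚᵘ i 0)) (ℚ.toℚᵘ-fromℚᵘ (mkℚᵘ j 0)) ⟩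
  mkℚᵘ i 0 ℚᵘ.+ mkℚᵘ j 0              ≡⟨ cong₂ (λ a b → mkℚᵘ (a ℤ.+ b) 0) (ℤ.*-identityʳ i) (ℤ.*-identityʳ j) ⟩
  mkℚᵘ (i ℤ.+ j) 0                    ≃⟨ ℚ.toℚᵘ-fromℚᵘ (mkℚᵘ (i ℤ.+ j) 0) ⟨
  ℚ.toℚᵘ ((i ℤ.+ j) / 1)              ∎
  where open ℚᵘ.≤-Reasoning

/-scale : ∀ i j n .{{_ : ℕ.NonZero n}} → (i / 1) ℚ.* (j / n) ≡ (i ℤ.* j) / n
/-scale i j (suc n) = ℚ.toℚᵘ-injective $ begin-equality
  ℚ.toℚᵘ (i / 1 ℚ.* (j / suc n))            ≃⟨ ℚ.toℚᵘ-homo-* (i / 1) (j / suc n) ⟩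
  ℚ.toℚᵘ (i / 1) ℚᵘ.* ℚ.toℚᵘ (j / suc n)    ≃⟨ ℚᵘ.*-cong (ℚ.toℚᵘ-fromℚᵘ (mkℚᵘ i 0)) (ℚ.toℚᵘ-fromℚᵘ (mkℚᵘ j n)) ⟩
  mkℚᵘ i 0 ℚᵘ.* mkℚᵘ j n                    ≡⟨ cong (mkℚᵘ (i ℤ.* j)) (ℕ.+-identityʳ n) ⟩
  mkℚᵘ (i ℤ.* j) n                          ≃⟨ ℚ.toℚᵘ-fromℚᵘ (mkℚᵘ (i ℤ.* j) n) ⟨
  ℚ.toℚᵘ ((i ℤ.* j) / suc n)                ∎
  where open ℚᵘ.≤-Reasoning

/-cancelˡ : ∀ m i n .{{_ : ℕ.NonZero n}} .{{_ : ℕ.NonZero (m ℕ.* n)}} →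
            (+ m ℤ.* i) / (m ℕ.* n) ≡ i / n
/-cancelˡ (suc m) i (suc n) = ℚ.fromℚᵘ-cong (ℚᵘ.*-cancelˡ-/ (suc m) {i} {suc n})

/-neg : ∀ i n .{{_ : ℕ.NonZero n}} → (ℤ.- i) / n ≡ ℚ.- (i / n)
/-neg i n = begin
  (ℤ.- i) / n           ≡⟨ cong (λ j → j / n) (ℤ.-1*i≡-i i) ⟨
  (-1ℤ ℤ.* i) / n       ≡⟨ /-scale -1ℤ i n ⟨
  (-1ℤ / 1) ℚ.* (i / n) ≡⟨ ℚ.neg-distribˡ-* 1ℚ (i / n) ⟨
  ℚ.- (1ℚ ℚ.* (i / n))  ≡⟨ cong ℚ.-_ (ℚ.*-identityˡ (i / n)) ⟩
  ℚ.- (i / n)           ∎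
  where open ≡-Reasoning

ι : ℕ → ℚ
ι n = + n / 1

ι-suc : ∀ n → ι (suc n) ≡ 1ℚ ℚ.+ ι n
ι-suc n = sym (/1-homo-+ 1ℤ (+ n))

ι-cancelˡ : ∀ n .{{_ : ℕ.NonZero n}} {x y} → ι n ℚ.* x ≡ ι n ℚ.* y → x ≡ y
ι-cancelˡ (suc n) {x} {y} eq = begin
  x                            ≡⟨ undo x ⟨
  w ℚ.* (ι (suc n) ℚ.* x)      ≡⟨ cong (w ℚ.*_) eq ⟩
  w ℚ.* (ι (suc n) ℚ.* y)      ≡⟨ undo y ⟩
  y                            ∎
  where
  open ≡-Reasoning
  instance
    ι≢0 : ℚ.NonZero (ι (suc n))
    ι≢0 = ℚ.pos⇒nonZero (ι (suc n)) {{ℚ.normalize-pos (suc n) 1}}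
  w = ℚ.1/ ι (suc n)
  undo : ∀ z → w ℚ.* (ι (suc n) ℚ.* z) ≡ z
  undo z = begin
    w ℚ.* (ι (suc n) ℚ.* z) ≡⟨ ℚ.*-assoc w (ι (suc n)) z ⟨
    w ℚ.* ι (suc n) ℚ.* z   ≡⟨ cong (ℚ._* z) (ℚ.*-inverseˡ (ι (suc n))) ⟩
    1ℚ ℚ.* z                ≡⟨ ℚ.*-identityˡ z ⟩
    z                       ∎

-- Turns the symmetry of `sec` and `tan` under x ↦ -x into the vanishing of every second
-- coefficient.
x≡-x⇒x≡0 : ∀ x → x ≡ ℚ.- x → x ≡ 0ℚ
x≡-x⇒x≡0 x eq = ι-cancelˡ 2 $ begin
  ι 2 ℚ.* x                 ≡⟨⟩
  (1ℚ ℚ.+ 1ℚ) ℚ.* x         ≡⟨ ℚ.*-distribʳ-+ x 1ℚ 1ℚ ⟩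
  1ℚ ℚ.* x ℚ.+ 1ℚ ℚ.* x     ≡⟨ cong₂ ℚ._+_ (ℚ.*-identityˡ x) (ℚ.*-identityˡ x) ⟩
  x ℚ.+ x                   ≡⟨ cong (x ℚ.+_) eq ⟩
  x ℚ.- x                   ≡⟨ ℚ.+-inverseʳ x ⟩
  0ℚ                        ≡⟨ ℚ.*-zeroʳ (ι 2) ⟨
  ι 2 ℚ.* 0ℚ                ∎
  where open ≡-Reasoning

-- The differential ring of formal power series

infix 8 ⊖_

𝟘 : PowerSeries
𝟘 _ = 0ℚ

⊖_ : PowerSeries → PowerSeries
(⊖ f) n = ℚ.- f n

D : PowerSeries → PowerSeries
D f n = ι (suc n) ℚ.* f (suc n)

D-cong : ∀ {f g} → f ≈ g → D f ≈ D g
D-cong f≈g n = cong (ι (suc n) ℚ.*_) (f≈g (suc n))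

D-⊕ : ∀ f g → D (f ⊕ g) ≈ D f ⊕ D g
D-⊕ f g n = ℚ.*-distribˡ-+ (ι (suc n)) (f (suc n)) (g (suc n))

D-one : D one ≈ 𝟘
D-one n = ℚ.*-zeroʳ (ι (suc n))

⊛-cong : ∀ {f f′ g g′} → f ≈ f′ → g ≈ g′ → f ⊛ g ≈ f′ ⊛ g′
⊛-cong f≈f′ g≈g′ n = sum-cong-≗ ℚ.+-0-monoid {suc n} (λ i → cong₂ ℚ._*_ (f≈f′ (toℕ i)) (g≈g′ (n ∸ toℕ i)))

⊛-distribʳ-⊕ : ∀ h f g → (f ⊕ g) ⊛ h ≈ (f ⊛ h) ⊕ (g ⊛ h)
⊛-distribʳ-⊕ h f g zero    =
  solve 3 (λ a b c → (a :+ b) :* c :+ con 0ℚ := (a :* c :+ con 0ℚ) :+ (b :* c :+ con 0ℚ)) refl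
    (f 0) (g 0) (h 0)
  where open ℚSolver.+-*-Solver
⊛-distribʳ-⊕ h f g (suc n) = trans
  (cong ((f 0 ℚ.+ g 0) ℚ.* h (suc n) ℚ.+_) (⊛-distribʳ-⊕ h (f ∘ suc) (g ∘ suc) n))
  (solve 5 (λ a b c x y → (a :+ b) :* c :+ (x :+ y) := (a :* c :+ x) :+ (b :* c :+ y)) refl
    (f 0) (g 0) (h (suc n)) (((f ∘ suc) ⊛ h) n) (((g ∘ suc) ⊛ h) n))
  where open ℚSolver.+-*-Solver

⊛-zeroˡ : ∀ f → 𝟘 ⊛ f ≈ 𝟘
⊛-zeroˡ f zero    = trans (ℚ.+-identityʳ _) (ℚ.*-zeroˡ (f 0))
⊛-zeroˡ f (suc n) = cong₂ ℚ._+_ (ℚ.*-zeroˡ (f (suc n))) (⊛-zeroˡ f n)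

-- Composition with `suc` drops the constant term and divides by x. For f = f 0 + x h the derivative
-- is h + x h′, and dropping its constant term gives this formula.
D-suc : ∀ f → D f ∘ suc ≈ (f ∘ suc ∘ suc) ⊕ D (f ∘ suc)
D-suc f n = trans (cong (ℚ._* x) (ι-suc (suc n)))
  (trans (ℚ.*-distribʳ-+ x 1ℚ (ι (suc n))) (cong (ℚ._+ ι (suc n) ℚ.* x) (ℚ.*-identityˡ x)))
  where x = f (suc (suc n))

-- Leibniz rule, by induction on the coefficient. A convolution at `suc n` unfolds to its first term
-- plus the convolution of the shifted left factor at `n`, so the induction hypothesis is applied to
-- `f ∘ suc`.
D-⊛ : ∀ f g → D (f ⊛ g) ≈ (D f ⊛ g) ⊕ (f ⊛ D g)
D-⊛ f g zero =
  solve 4 (λ f₀ f₁ g₀ g₁ → con 1ℚ :* (f₀ :* g₁ :+ (f₁ :* g₀ :+ con 0ℚ)) :=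
                           ((con 1ℚ :* f₁) :* g₀ :+ con 0ℚ) :+ (f₀ :* (con 1ℚ :* g₁) :+ con 0ℚ)) refl
    (f 0) (f 1) (g 0) (g 1)
  where open ℚSolver.+-*-Solver
D-⊛ f g (suc n) = begin
  k ℚ.* (f 0 ℚ.* g₂ ℚ.+ X)                                ≡⟨ ℚ.*-distribˡ-+ k (f 0 ℚ.* g₂) X ⟩
  k ℚ.* (f 0 ℚ.* g₂) ℚ.+ k ℚ.* X                          ≡⟨ cong (k ℚ.* (f 0 ℚ.* g₂) ℚ.+_) kX ⟩
  k ℚ.* (f 0 ℚ.* g₂) ℚ.+ (X ℚ.+ (Y ℚ.+ Z))                ≡⟨ arrange ⟩
  ((1ℚ ℚ.* f 1) ℚ.* g₁ ℚ.+ (X′ ℚ.+ Y)) ℚ.+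
    (f 0 ℚ.* (k ℚ.* g₂) ℚ.+ Z)                            ≡⟨ cong (λ w → ((1ℚ ℚ.* f 1) ℚ.* g₁ ℚ.+ w) ℚ.+ (f 0 ℚ.* (k ℚ.* g₂) ℚ.+ Z)) X′+Y ⟩
  ((1ℚ ℚ.* f 1) ℚ.* g₁ ℚ.+ ((D f ∘ suc) ⊛ g) n) ℚ.+
    (f 0 ℚ.* (k ℚ.* g₂) ℚ.+ Z)                            ∎
  where
  open ≡-Reasoning
  k X X′ Y Z g₁ g₂ : ℚ
  k = ι (suc (suc n))
  g₁ = g (suc n)
  g₂ = g (suc (suc n))
  X = ((f ∘ suc) ⊛ g) (suc n)
  X′ = ((f ∘ suc ∘ suc) ⊛ g) n
  Y = (D (f ∘ suc) ⊛ g) n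
  Z = ((f ∘ suc) ⊛ D g) n
  kX : k ℚ.* X ≡ X ℚ.+ (Y ℚ.+ Z)
  -- Since k = 1 + (n + 1), one copy of `X` splits off and the other n + 1 form a coefficient of D
  -- ((f ∘ suc) ⊛ g).
  kX = trans (cong (ℚ._* X) (ι-suc (suc n)))
    (trans (ℚ.*-distribʳ-+ X 1ℚ (ι (suc n))) (cong₂ ℚ._+_ (ℚ.*-identityˡ X) (D-⊛ (f ∘ suc) g n)))
  X′+Y : X′ ℚ.+ Y ≡ ((D f ∘ suc) ⊛ g) n
  X′+Y = sym (trans (⊛-cong {g = g} (D-suc f) (λ _ → refl) n) (⊛-distribʳ-⊕ g (f ∘ suc ∘ suc) (D (f ∘ suc)) n))
  arrange : k ℚ.* (f 0 ℚ.* g₂) ℚ.+ (X ℚ.+ (Y ℚ.+ Z)) ≡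
            ((1ℚ ℚ.* f 1) ℚ.* g₁ ℚ.+ (X′ ℚ.+ Y)) ℚ.+ (f 0 ℚ.* (k ℚ.* g₂) ℚ.+ Z)
  arrange = solve 8 (λ k f₀ f₁ g₁ g₂ x y z →
      k :* (f₀ :* g₂) :+ ((f₁ :* g₁ :+ x) :+ (y :+ z)) :=
      ((con 1ℚ :* f₁) :* g₁ :+ (x :+ y)) :+ (f₀ :* (k :* g₂) :+ z)) refl
    k (f 0) (f 1) g₁ g₂ X′ Y Z
    where open ℚSolver.+-*-Solver

D-injective : ∀ {f g : PowerSeries} n → D f n ≡ D g n → f (suc n) ≡ g (suc n)
D-injective n = ι-cancelˡ (suc n)

⊛-identityˡ : ∀ f → one ⊛ f ≈ f
⊛-identityˡ f zero    = trans (ℚ.+-identityʳ _) (ℚ.*-identityˡ (f 0))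
⊛-identityˡ f (suc n) = trans (cong₂ ℚ._+_ (ℚ.*-identityˡ (f (suc n))) (⊛-zeroˡ f n)) (ℚ.+-identityʳ (f (suc n)))

-- The ring laws hold at 0, and by the Leibniz rule they propagate from n to n + 1.
⊛-comm : ∀ f g → f ⊛ g ≈ g ⊛ f
⊛-comm f g zero    = cong (ℚ._+ 0ℚ) (ℚ.*-comm (f 0) (g 0))
⊛-comm f g (suc n) = D-injective {f ⊛ g} {g ⊛ f} n $ begin
  D (f ⊛ g) n                    ≡⟨ D-⊛ f g n ⟩
  (D f ⊛ g) n ℚ.+ (f ⊛ D g) n    ≡⟨ cong₂ ℚ._+_ (⊛-comm (D f) g n) (⊛-comm f (D g) n) ⟩
  (g ⊛ D f) n ℚ.+ (D g ⊛ f) n    ≡⟨ ℚ.+-comm ((g ⊛ D f) n) ((D g ⊛ f) n) ⟩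
  (D g ⊛ f) n ℚ.+ (g ⊛ D f) n    ≡⟨ D-⊛ g f n ⟨
  D (g ⊛ f) n                    ∎
  where open ≡-Reasoning

⊛-distribˡ-⊕ : ∀ h f g → h ⊛ (f ⊕ g) ≈ (h ⊛ f) ⊕ (h ⊛ g)
⊛-distribˡ-⊕ h f g n = trans (⊛-comm h (f ⊕ g) n)
  (trans (⊛-distribʳ-⊕ h f g n) (cong₂ ℚ._+_ (⊛-comm f h n) (⊛-comm g h n)))

⊛-assoc : ∀ f g h → (f ⊛ g) ⊛ h ≈ f ⊛ (g ⊛ h)
⊛-assoc f g h zero    =
  solve 3 (λ a b c → (a :* b :+ con 0ℚ) :* c :+ con 0ℚ := a :* (b :* c :+ con 0ℚ) :+ con 0ℚ) refl
    (f 0) (g 0) (h 0)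
  where open ℚSolver.+-*-Solver
⊛-assoc f g h (suc n) = D-injective {(f ⊛ g) ⊛ h} {f ⊛ (g ⊛ h)} n $ begin
  D ((f ⊛ g) ⊛ h) n
    ≡⟨ D-⊛ (f ⊛ g) h n ⟩
  (D (f ⊛ g) ⊛ h) n ℚ.+ ((f ⊛ g) ⊛ D h) n
    ≡⟨ cong (ℚ._+ ((f ⊛ g) ⊛ D h) n) (trans (⊛-cong {g = h} (D-⊛ f g) (λ _ → refl) n) (⊛-distribʳ-⊕ h (D f ⊛ g) (f ⊛ D g) n)) ⟩
  (((D f ⊛ g) ⊛ h) n ℚ.+ ((f ⊛ D g) ⊛ h) n) ℚ.+ ((f ⊛ g) ⊛ D h) n
    ≡⟨ cong₂ ℚ._+_ (cong₂ ℚ._+_ (⊛-assoc (D f) g h n) (⊛-assoc f (D g) h n)) (⊛-assoc f g (D h) n) ⟩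
  ((D f ⊛ (g ⊛ h)) n ℚ.+ (f ⊛ (D g ⊛ h)) n) ℚ.+ (f ⊛ (g ⊛ D h)) n
    ≡⟨ ℚ.+-assoc ((D f ⊛ (g ⊛ h)) n) ((f ⊛ (D g ⊛ h)) n) ((f ⊛ (g ⊛ D h)) n) ⟩
  (D f ⊛ (g ⊛ h)) n ℚ.+ ((f ⊛ (D g ⊛ h)) n ℚ.+ (f ⊛ (g ⊛ D h)) n)
    ≡⟨ cong ((D f ⊛ (g ⊛ h)) n ℚ.+_) (trans (⊛-cong {f} {f} (λ _ → refl) (D-⊛ g h) n) (⊛-distribˡ-⊕ f (D g ⊛ h) (g ⊛ D h) n)) ⟨
  (D f ⊛ (g ⊛ h)) n ℚ.+ (f ⊛ D (g ⊛ h)) n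
    ≡⟨ D-⊛ f (g ⊛ h) n ⟨
  D (f ⊛ (g ⊛ h)) n ∎
  where open ≡-Reasoning

⟦x⟧-commutativeRing : CommutativeRing 0ℓ 0ℓ
⟦x⟧-commutativeRing = record
  { _≈_ = _≈_
  ; _+_ = _⊕_
  ; _*_ = _⊛_
  ; -_  = ⊖_
  ; 0#  = 𝟘
  ; 1#  = one
  ; isCommutativeRing = record
    { isRing = record
      { +-isAbelianGroup = Pointwise.isAbelianGroup ℕ ℚ.+-0-isAbelianGroup
      ; *-cong = ⊛-cong
      ; *-assoc = ⊛-assoc
      ; *-identity = ⊛-identityˡ , λ f n → trans (⊛-comm f one n) (⊛-identityˡ f n)
      ; distrib = ⊛-distribˡ-⊕ , ⊛-distribʳ-⊕
      }
    ; *-comm = ⊛-comm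
    }
  }

private module ⟦x⟧ = CommutativeRing ⟦x⟧-commutativeRing
-- This solver works in a commutative semiring, so series that involve negation, such as `𝑡`, are
-- passed to it as atoms.
private module ⟦x⟧-Solver = NaturalSolver ⟦x⟧.commutativeSemiring

-- The tangent series

-- The factor `suc n` introduced by `D` cancels against the one in the factorial.
D-egf : ∀ a → D (egf a) ≈ egf (a ∘ suc)
D-egf a n = trans (/-scale (+ suc n) (a (suc n)) (suc n !) {{suc n !≢0}})
  (/-cancelˡ (suc n) (a (suc n)) (n !) {{n !≢0}} {{suc n !≢0}})

egf-cong : ∀ {a b} → (∀ n → a n ≡ b n) → egf a ≈ egf b
egf-cong a≗b n = cong (λ i → (i / n !) {{n !≢0}}) (a≗b n)

cos-coeff-suc : ∀ n → cos-coeff (suc n) ≡ ℤ.- sin-coeff n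
cos-coeff-suc 0             = refl
cos-coeff-suc 1             = refl
cos-coeff-suc (suc (suc n)) = cong ℤ.-_ (cos-coeff-suc n)

sin-coeff-suc : ∀ n → sin-coeff (suc n) ≡ cos-coeff n
sin-coeff-suc 0             = refl
sin-coeff-suc 1             = refl
sin-coeff-suc (suc (suc n)) = cong ℤ.-_ (sin-coeff-suc n)

D-cos : D cos ≈ ⊖ sin
D-cos n = trans (D-egf cos-coeff n)
  (trans (egf-cong cos-coeff-suc n) (/-neg (sin-coeff n) (n !) {{n !≢0}}))

D-sin : D sin ≈ cos
D-sin n = trans (D-egf sin-coeff n) (egf-cong sin-coeff-suc n)

cos⊛sec : cos ⊛ sec ≈ one
cos⊛sec = reciprocal-inverseʳ cos

-- Multiplication by `sec` undoes multiplication by `cos`. Facts about `tan` and `sec` thus follow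
-- from facts about `sin` and `cos`.
cos-cancelˡ : ∀ {f g} → cos ⊛ f ≈ cos ⊛ g → f ≈ g
cos-cancelˡ {f} {g} eq = begin
  f                  ≈⟨ undo f ⟨
  sec ⊛ (cos ⊛ f)    ≈⟨ ⟦x⟧.*-congˡ {sec} eq ⟩
  sec ⊛ (cos ⊛ g)    ≈⟨ undo g ⟩
  g                  ∎
  where
  open SetoidReasoning ⟦x⟧.setoid
  undo : ∀ h → sec ⊛ (cos ⊛ h) ≈ h
  undo h = begin
    sec ⊛ (cos ⊛ h)   ≈⟨ ⊛-assoc sec cos h ⟨
    sec ⊛ cos ⊛ h     ≈⟨ ⟦x⟧.*-congʳ {h} (⊛-comm sec cos) ⟩
    cos ⊛ sec ⊛ h     ≈⟨ ⟦x⟧.*-congʳ {h} cos⊛sec ⟩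
    one ⊛ h           ≈⟨ ⊛-identityˡ h ⟩
    h                 ∎

cos⊛tan : cos ⊛ tan ≈ sin
cos⊛tan = begin
  cos ⊛ (sin ⊛ sec)   ≈⟨ ⊛-assoc cos sin sec ⟨
  cos ⊛ sin ⊛ sec     ≈⟨ ⟦x⟧.*-congʳ {sec} (⊛-comm cos sin) ⟩
  sin ⊛ cos ⊛ sec     ≈⟨ ⊛-assoc sin cos sec ⟩
  sin ⊛ (cos ⊛ sec)   ≈⟨ ⟦x⟧.*-congˡ {sin} cos⊛sec ⟩
  sin ⊛ one           ≈⟨ ⟦x⟧.*-identityʳ sin ⟩
  sin                 ∎
  where open SetoidReasoning ⟦x⟧.setoid

-- Differentiating cos · tan = sin gives cos · tan′ - sin · tan = cos. Replacing sin by cos · tan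
-- and cancelling `cos` yields the claim.
D-tan : D tan ≈ one ⊕ tan ⊛ tan
D-tan = cos-cancelˡ $ begin
  cos ⊛ D tan                                      ≈⟨ ⟦x⟧.+-identityʳ (cos ⊛ D tan) ⟨
  cos ⊛ D tan ⊕ 𝟘                                  ≈⟨ ⟦x⟧.+-congˡ {cos ⊛ D tan} (⟦x⟧.-‿inverseˡ (sin ⊛ tan)) ⟨
  cos ⊛ D tan ⊕ (⊖ (sin ⊛ tan) ⊕ sin ⊛ tan)        ≈⟨ ⟦x⟧.+-assoc (cos ⊛ D tan) (⊖ (sin ⊛ tan)) (sin ⊛ tan) ⟨
  cos ⊛ D tan ⊕ ⊖ (sin ⊛ tan) ⊕ sin ⊛ tan          ≈⟨ ⟦x⟧.+-cong derivative (⟦x⟧.*-congʳ {tan} (⟦x⟧.sym cos⊛tan)) ⟩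
  cos ⊕ cos ⊛ tan ⊛ tan                            ≈⟨ ⟦x⟧.+-cong (⟦x⟧.sym (⟦x⟧.*-identityʳ cos)) (⊛-assoc cos tan tan) ⟩
  cos ⊛ one ⊕ cos ⊛ (tan ⊛ tan)                    ≈⟨ ⊛-distribˡ-⊕ cos one (tan ⊛ tan) ⟨
  cos ⊛ (one ⊕ tan ⊛ tan)                          ∎
  where
  open SetoidReasoning ⟦x⟧.setoid
  derivative : cos ⊛ D tan ⊕ ⊖ (sin ⊛ tan) ≈ cos
  derivative = begin
    cos ⊛ D tan ⊕ ⊖ (sin ⊛ tan)    ≈⟨ ⟦x⟧.+-congˡ {cos ⊛ D tan} (RingProperties.-‿distribˡ-* ⟦x⟧.ring sin tan) ⟩
    cos ⊛ D tan ⊕ ⊖ sin ⊛ tan      ≈⟨ ⟦x⟧.+-congˡ {cos ⊛ D tan} (⟦x⟧.*-congʳ {tan} D-cos) ⟨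
    cos ⊛ D tan ⊕ D cos ⊛ tan      ≈⟨ ⟦x⟧.+-comm (cos ⊛ D tan) (D cos ⊛ tan) ⟩
    D cos ⊛ tan ⊕ cos ⊛ D tan      ≈⟨ D-⊛ cos tan ⟨
    D (cos ⊛ tan)                  ≈⟨ D-cong cos⊛tan ⟩
    D sin                          ≈⟨ D-sin ⟩
    cos                            ∎

-- The substitution x ↦ -x

ε : ℕ → ℚ
ε zero    = 1ℚ
ε (suc n) = ℚ.- ε n

reflect : PowerSeries → PowerSeries
reflect f n = ε n ℚ.* f n

reflect-⊛ : ∀ f g → reflect (f ⊛ g) ≈ reflect f ⊛ reflect g
reflect-⊛ f g zero =
  solve 2 (λ a b → con 1ℚ :* (a :* b :+ con 0ℚ) := (con 1ℚ :* a) :* (con 1ℚ :* b) :+ con 0ℚ) refl (f 0) (g 0)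
  where open ℚSolver.+-*-Solver
reflect-⊛ f g (suc n) = begin
  ℚ.- ε n ℚ.* (f 0 ℚ.* g (suc n) ℚ.+ X)
    ≡⟨ solve 4 (λ e a b x → :- e :* (a :* b :+ x) := (con 1ℚ :* a) :* (:- e :* b) :+ :- (e :* x)) refl
         (ε n) (f 0) (g (suc n)) X ⟩
  (1ℚ ℚ.* f 0) ℚ.* (ℚ.- ε n ℚ.* g (suc n)) ℚ.+ ℚ.- (ε n ℚ.* X)
    ≡⟨ cong ((1ℚ ℚ.* f 0) ℚ.* (ℚ.- ε n ℚ.* g (suc n)) ℚ.+_) tail-eq ⟩
  (1ℚ ℚ.* f 0) ℚ.* (ℚ.- ε n ℚ.* g (suc n)) ℚ.+ ((reflect f ∘ suc) ⊛ reflect g) n ∎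
  where
  open ≡-Reasoning
  open ℚSolver.+-*-Solver
  X : ℚ
  X = ((f ∘ suc) ⊛ g) n
  tail-eq : ℚ.- (ε n ℚ.* X) ≡ ((reflect f ∘ suc) ⊛ reflect g) n
  tail-eq = begin
    ℚ.- (ε n ℚ.* X)                          ≡⟨ cong ℚ.-_ (reflect-⊛ (f ∘ suc) g n) ⟩
    (⊖ (reflect (f ∘ suc) ⊛ reflect g)) n    ≡⟨ RingProperties.-‿distribˡ-* ⟦x⟧.ring (reflect (f ∘ suc)) (reflect g) n ⟩
    -- Shifting by one index costs one sign: `reflect f ∘ suc` is the negative of
    -- `reflect (f ∘ suc)`.
    (⊖ reflect (f ∘ suc) ⊛ reflect g) n      ≡⟨ ⊛-cong {g = reflect g} (λ i → ℚ.neg-distribˡ-* (ε i) (f (suc i))) (λ _ → refl) n ⟩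
    ((reflect f ∘ suc) ⊛ reflect g) n        ∎

neg-* : ∀ x y → ℚ.- ℚ.- x ℚ.* ℚ.- y ≡ ℚ.- (x ℚ.* y)
neg-* = solve 2 (λ x y → :- :- x :* :- y := :- (x :* y)) refl
  where open ℚSolver.+-*-Solver

-- The denominator `m` is kept independent of `n`, because the recursion lowers `n` by two while the
-- denominator must stay fixed. It becomes `n !` afterwards.
ε*cos : ∀ n m .{{_ : ℕ.NonZero m}} → ε n ℚ.* (cos-coeff n / m) ≡ cos-coeff n / m
ε*cos 0 m = ℚ.*-identityˡ (1ℤ / m)
ε*cos 1 m = trans (cong (ε 1 ℚ.*_) (ℚ.0/n≡0 m)) (sym (ℚ.0/n≡0 m))
ε*cos (suc (suc n)) m = begin
  ε (suc (suc n)) ℚ.* ((ℤ.- cos-coeff n) / m)   ≡⟨ cong (ε (suc (suc n)) ℚ.*_) (/-neg (cos-coeff n) m) ⟩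
  ε (suc (suc n)) ℚ.* ℚ.- (cos-coeff n / m)     ≡⟨ neg-* (ε n) (cos-coeff n / m) ⟩
  ℚ.- (ε n ℚ.* (cos-coeff n / m))               ≡⟨ cong ℚ.-_ (ε*cos n m) ⟩
  ℚ.- (cos-coeff n / m)                         ≡⟨ /-neg (cos-coeff n) m ⟨
  (ℤ.- cos-coeff n) / m                         ∎
  where open ≡-Reasoning

ε*sin : ∀ n m .{{_ : ℕ.NonZero m}} → ε n ℚ.* (sin-coeff n / m) ≡ ℚ.- (sin-coeff n / m)
ε*sin 0 m = trans (ℚ.*-identityˡ (0ℤ / m)) (trans (ℚ.0/n≡0 m) (cong ℚ.-_ (sym (ℚ.0/n≡0 m))))
ε*sin 1 m = trans (sym (ℚ.neg-distribˡ-* 1ℚ (1ℤ / m))) (cong ℚ.-_ (ℚ.*-identityˡ (1ℤ / m)))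
ε*sin (suc (suc n)) m = begin
  ε (suc (suc n)) ℚ.* ((ℤ.- sin-coeff n) / m)   ≡⟨ cong (ε (suc (suc n)) ℚ.*_) (/-neg (sin-coeff n) m) ⟩
  ε (suc (suc n)) ℚ.* ℚ.- (sin-coeff n / m)     ≡⟨ neg-* (ε n) (sin-coeff n / m) ⟩
  ℚ.- (ε n ℚ.* (sin-coeff n / m))               ≡⟨ cong ℚ.-_ (ε*sin n m) ⟩
  ℚ.- ℚ.- (sin-coeff n / m)                     ≡⟨ cong ℚ.-_ (/-neg (sin-coeff n) m) ⟨
  ℚ.- ((ℤ.- sin-coeff n) / m)                   ∎
  where open ≡-Reasoning

reflect-cos : reflect cos ≈ cos
reflect-cos n = ε*cos n (n !) {{n !≢0}}

reflect-sin : reflect sin ≈ ⊖ sin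
reflect-sin n = ε*sin n (n !) {{n !≢0}}

reflect-one : reflect one ≈ one
reflect-one zero    = refl
reflect-one (suc n) = ℚ.*-zeroʳ (ε (suc n))

-- As `cos` is even, `reflect sec` is again a reciprocal of `cos`, and reciprocals are unique.
reflect-sec : reflect sec ≈ sec
reflect-sec = cos-cancelˡ $ begin
  cos ⊛ reflect sec           ≈⟨ ⟦x⟧.*-congʳ {reflect sec} reflect-cos ⟨
  reflect cos ⊛ reflect sec   ≈⟨ reflect-⊛ cos sec ⟨
  reflect (cos ⊛ sec)         ≈⟨ (λ n → cong (ε n ℚ.*_) (cos⊛sec n)) ⟩
  reflect one                 ≈⟨ reflect-one ⟩
  one                         ≈⟨ cos⊛sec ⟨
  cos ⊛ sec                   ∎
  where open SetoidReasoning ⟦x⟧.setoid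

reflect-tan : reflect tan ≈ ⊖ tan
reflect-tan = begin
  reflect (sin ⊛ sec)         ≈⟨ reflect-⊛ sin sec ⟩
  reflect sin ⊛ reflect sec   ≈⟨ ⟦x⟧.*-cong reflect-sin reflect-sec ⟩
  ⊖ sin ⊛ sec                 ≈⟨ RingProperties.-‿distribˡ-* ⟦x⟧.ring sin sec ⟨
  ⊖ tan                       ∎
  where open SetoidReasoning ⟦x⟧.setoid

ε-even : ∀ n → parity n ≡ 0ℙ → ε n ≡ 1ℚ
ε-even 0             _    = refl
ε-even (suc (suc n)) even = cong (ℚ.-_ ∘ ℚ.-_) (ε-even n even)

ε-odd : ∀ n → parity n ≡ 1ℙ → ε n ≡ ℚ.- 1ℚ
ε-odd 1             _   = refl
ε-odd (suc (suc n)) odd = cong (ℚ.-_ ∘ ℚ.-_) (ε-odd n odd)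

tan-even : ∀ n → parity n ≡ 0ℙ → tan n ≡ 0ℚ
tan-even n even = x≡-x⇒x≡0 (tan n) $ begin
  tan n             ≡⟨ ℚ.*-identityˡ (tan n) ⟨
  1ℚ ℚ.* tan n      ≡⟨ cong (ℚ._* tan n) (ε-even n even) ⟨
  reflect tan n     ≡⟨ reflect-tan n ⟩
  ℚ.- tan n         ∎
  where open ≡-Reasoning

sec-odd : ∀ n → parity n ≡ 1ℙ → sec n ≡ 0ℚ
sec-odd n odd = x≡-x⇒x≡0 (sec n) $ begin
  sec n                  ≡⟨ reflect-sec n ⟨
  reflect sec n          ≡⟨ cong (ℚ._* sec n) (ε-odd n odd) ⟩
  ℚ.- 1ℚ ℚ.* sec n       ≡⟨ ℚ.neg-distribˡ-* 1ℚ (sec n) ⟨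
  ℚ.- (1ℚ ℚ.* sec n)     ≡⟨ cong ℚ.-_ (ℚ.*-identityˡ (sec n)) ⟩
  ℚ.- sec n              ∎
  where open ≡-Reasoning

-- Weights of permutations

∑ : {A : Set} → (A → PowerSeries) → List A → PowerSeries
∑ f = foldr (λ x → f x ⊕_) 𝟘

-- Agreement is required on members only: the insertion identity is available for nonempty words
-- whose letters lie below the new maximum.
∑-cong-∈ : ∀ {A : Set} {f g : A → PowerSeries} xs → (∀ {x} → x ∈ xs → f x ≈ g x) → ∑ f xs ≈ ∑ g xs
∑-cong-∈ []       f≈g = ⟦x⟧.refl {𝟘}
∑-cong-∈ (x ∷ xs) f≈g = ⟦x⟧.+-cong (f≈g (here refl)) (∑-cong-∈ xs (f≈g ∘ there))

∑-map : ∀ {A B : Set} (f : B → PowerSeries) (g : A → B) xs → ∑ f (map g xs) ≡ ∑ (f ∘ g) xs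
∑-map f g []       = refl
∑-map f g (x ∷ xs) = cong (f (g x) ⊕_) (∑-map f g xs)

∑-++ : ∀ {A : Set} (f : A → PowerSeries) xs ys → ∑ f (xs ++ ys) ≈ ∑ f xs ⊕ ∑ f ys
∑-++ f []       ys = ⟦x⟧.sym (⟦x⟧.+-identityˡ (∑ f ys))
∑-++ f (x ∷ xs) ys = ⟦x⟧.trans (⟦x⟧.+-congˡ {f x} (∑-++ f xs ys))
  (⟦x⟧.sym (⟦x⟧.+-assoc (f x) (∑ f xs) (∑ f ys)))

∑-concatMap : ∀ {A B : Set} (f : B → PowerSeries) (g : A → List B) xs →
              ∑ f (concatMap g xs) ≈ ∑ (∑ f ∘ g) xs
∑-concatMap f g []       = ⟦x⟧.refl {𝟘}
∑-concatMap f g (x ∷ xs) = ⟦x⟧.trans (∑-++ f (g x) (concatMap g xs))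
  (⟦x⟧.+-congˡ {∑ f (g x)} (∑-concatMap f g xs))

∑-↭ : ∀ {A : Set} (f : A → PowerSeries) {xs ys} → xs ↭ ys → ∑ f xs ≈ ∑ f ys
∑-↭ f {xs} ↭.refl       = ⟦x⟧.refl {∑ f xs}
∑-↭ f (↭.prep x p)      = ⟦x⟧.+-congˡ {f x} (∑-↭ f p)
∑-↭ f {_ ∷ _ ∷ xs} {_ ∷ _ ∷ ys} (↭.swap x y p) = begin
  f x ⊕ (f y ⊕ ∑ f xs)   ≈⟨ ⟦x⟧.+-assoc (f x) (f y) (∑ f xs) ⟨
  f x ⊕ f y ⊕ ∑ f xs     ≈⟨ ⟦x⟧.+-cong (⟦x⟧.+-comm (f x) (f y)) (∑-↭ f p) ⟩
  f y ⊕ f x ⊕ ∑ f ys     ≈⟨ ⟦x⟧.+-assoc (f y) (f x) (∑ f ys) ⟩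
  f y ⊕ (f x ⊕ ∑ f ys)   ∎
  where open SetoidReasoning ⟦x⟧.setoid
∑-↭ f (↭.trans p q)     = ⟦x⟧.trans (∑-↭ f p) (∑-↭ f q)

∑-⊛ : ∀ {A : Set} g (f : A → PowerSeries) xs → ∑ (λ x → g ⊛ f x) xs ≈ g ⊛ ∑ f xs
∑-⊛ g f []       = ⟦x⟧.sym (⟦x⟧.zeroʳ g)
∑-⊛ g f (x ∷ xs) = ⟦x⟧.trans (⟦x⟧.+-congˡ {g ⊛ f x} (∑-⊛ g f xs))
  (⟦x⟧.sym (⊛-distribˡ-⊕ g (f x) (∑ f xs)))

D-∑ : ∀ {A : Set} (f : A → PowerSeries) xs → D (∑ f xs) ≈ ∑ (D ∘ f) xs
D-∑ f []       n = ℚ.*-zeroʳ (ι (suc n))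
D-∑ f (x ∷ xs) = ⟦x⟧.trans (D-⊕ (f x) (∑ f xs)) (⟦x⟧.+-congˡ {D (f x)} (D-∑ f xs))

-- The letter weights and their derivatives

𝑞 𝑠 𝑡 : PowerSeries
𝑞 = one ⊕ tan ⊛ tan
𝑠 = tan ⊕ one
𝑡 = tan ⊕ ⊖ one

D-𝑠 : D 𝑠 ≈ 𝑞
D-𝑠 = begin
  D (tan ⊕ one)      ≈⟨ D-⊕ tan one ⟩
  D tan ⊕ D one      ≈⟨ ⟦x⟧.+-cong D-tan D-one ⟩
  𝑞 ⊕ 𝟘              ≈⟨ ⟦x⟧.+-identityʳ 𝑞 ⟩
  𝑞                  ∎
  where open SetoidReasoning ⟦x⟧.setoid

D-𝑡 : D 𝑡 ≈ 𝑞
D-𝑡 = begin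
  D (tan ⊕ ⊖ one)      ≈⟨ D-⊕ tan (⊖ one) ⟩
  D tan ⊕ D (⊖ one)    ≈⟨ ⟦x⟧.+-cong D-tan (λ n → ℚ.*-zeroʳ (ι (suc n))) ⟩
  𝑞 ⊕ 𝟘                ≈⟨ ⟦x⟧.+-identityʳ 𝑞 ⟩
  𝑞                    ∎
  where open SetoidReasoning ⟦x⟧.setoid

𝑠⊕𝑡 : 𝑠 ⊕ 𝑡 ≈ tan ⊕ tan
𝑠⊕𝑡 n = solve 2 (λ x e → (x :+ e) :+ (x :+ :- e) := x :+ x) refl (tan n) (one n)
  where open ℚSolver.+-*-Solver

-- The chain rule gives 2 tan · tan′, where 2 tan = 𝑠 + 𝑡 and tan′ = 𝑞.
D-𝑞 : D 𝑞 ≈ (𝑠 ⊕ 𝑡) ⊛ 𝑞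
D-𝑞 = begin
  D (one ⊕ tan ⊛ tan)                ≈⟨ D-⊕ one (tan ⊛ tan) ⟩
  D one ⊕ D (tan ⊛ tan)              ≈⟨ ⟦x⟧.+-cong D-one (D-⊛ tan tan) ⟩
  𝟘 ⊕ (D tan ⊛ tan ⊕ tan ⊛ D tan)    ≈⟨ ⟦x⟧.+-identityˡ (D tan ⊛ tan ⊕ tan ⊛ D tan) ⟩
  D tan ⊛ tan ⊕ tan ⊛ D tan          ≈⟨ ⟦x⟧.+-congʳ {tan ⊛ D tan} (⊛-comm (D tan) tan) ⟩
  tan ⊛ D tan ⊕ tan ⊛ D tan          ≈⟨ ⊛-distribʳ-⊕ (D tan) tan tan ⟨
  (tan ⊕ tan) ⊛ D tan                ≈⟨ ⟦x⟧.*-cong (⟦x⟧.sym 𝑠⊕𝑡) D-tan ⟩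
  (𝑠 ⊕ 𝑡) ⊛ 𝑞                        ∎
  where open SetoidReasoning ⟦x⟧.setoid

-- The arguments tell whether the steps entering and leaving a letter are descents.
ω : Bool → Bool → PowerSeries
ω true  true  = 𝑡
ω true  false = 𝑞
ω false true  = one
ω false false = 𝑠

-- Reduces to the same Boolean as `<⁺?` on finite letters, so the weights and `ddes` branch on the
-- same test.
_>ᵈ_ : ℕ → ℕ → Bool
b >ᵈ c = does (c ℕ.<? b)

-- δ tells whether the step entering b is a descent; the last letter is
-- followed by ∞, hence left by an ascent.
suffixWeight : Bool → ℕ → List ℕ → PowerSeries
suffixWeight δ b []      = ω δ false
suffixWeight δ b (c ∷ w) = ω δ (b >ᵈ c) ⊛ suffixWeight (b >ᵈ c) c w

-- The flag `true` records the step down from the bordering ∞ to the first letter.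
weight : List ℕ → PowerSeries
weight []      = one
weight (b ∷ w) = suffixWeight true b w

-- Insertion of a new maximum as differentiation of weights

insertions : ℕ → List ℕ → List (List ℕ)
insertions N []      = (N ∷ []) ∷ []
insertions N (b ∷ w) = (N ∷ b ∷ w) ∷ map (b ∷_) (insertions N w)

-- Only the places after `b` are counted; the place directly before `b` belongs to the preceding
-- letter.
∑suffix : ℕ → Bool → ℕ → List ℕ → PowerSeries
∑suffix N δ b w = ∑ (suffixWeight δ b) (insertions N w)

-- Between `b` and `c` the letter `N` is a peak of weight `one`; `b` is now left by an ascent and
-- `c` entered by a descent.
suffixWeight-insert : ∀ {N} δ {b c} w → b < N → c < N →
  suffixWeight δ b (N ∷ c ∷ w) ≡ ω δ false ⊛ (one ⊛ suffixWeight true c w)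
suffixWeight-insert {N} δ {b} {c} w b<N c<N
  rewrite dec-false (N ℕ.<? b) (ℕ.<-asym b<N) | dec-true (c ℕ.<? N) c<N = refl

-- Either `N` directly follows `b`, or it comes after `c`; in the second case `b` keeps its weight,
-- which factors out.
∑suffix-∷ : ∀ {N} δ {b c} w → b < N → c < N →
  ∑suffix N δ b (c ∷ w) ≈
  ω δ false ⊛ (one ⊛ suffixWeight true c w) ⊕ ω δ (b >ᵈ c) ⊛ ∑suffix N (b >ᵈ c) c w
∑suffix-∷ {N} δ {b} {c} w b<N c<N = ⟦x⟧.+-cong
  (⟦x⟧.reflexive (suffixWeight-insert δ w b<N c<N))
  (⟦x⟧.trans (⟦x⟧.reflexive (∑-map (suffixWeight δ b) (c ∷_) (insertions N w)))
             (∑-⊛ (ω δ (b >ᵈ c)) (suffixWeight (b >ᵈ c) c) (insertions N w)))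

-- Inserting N directly before b turns an ascent into b into a descent into b:
-- hence the term suffixWeight true b w in the second equation.  The two
-- equations are arranged to avoid subtraction.
mutual
  ∑suffix-descent : ∀ {N b} w → b < N → All (_< N) w →
    ∑suffix N true b w ⊕ 𝑡 ⊛ suffixWeight true b w ≈ D (suffixWeight true b w)
  -- The only place is after the last letter: `N` is a double ascent of weight `𝑠`, and `b` remains
  -- a valley of weight `𝑞`.
  ∑suffix-descent {N} {b} [] b<N [] rewrite dec-false (N ℕ.<? b) (ℕ.<-asym b<N) = ⟦x⟧.trans
    (solve 3 (λ q s t → q :* s :+ con 0 :+ t :* q := (s :+ t) :* q) (λ _ → refl) 𝑞 𝑠 𝑡)
    (⟦x⟧.sym D-𝑞)
    where open ⟦x⟧-Solver
  ∑suffix-descent {N} {b} (c ∷ w) b<N (c<N ∷ w<N) = ⟦x⟧.trans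
    (⟦x⟧.+-congʳ {𝑡 ⊛ suffixWeight true b (c ∷ w)} (∑suffix-∷ true w b<N c<N)) (go (b >ᵈ c))
    where
    open ⟦x⟧-Solver
    open SetoidReasoning ⟦x⟧.setoid
    L : Bool → PowerSeries
    L e = suffixWeight e c w
    S : Bool → PowerSeries
    S e = ∑suffix N e c w
    go : ∀ e → 𝑞 ⊛ (one ⊛ L true) ⊕ ω true e ⊛ S e ⊕ 𝑡 ⊛ (ω true e ⊛ L e) ≈ D (ω true e ⊛ L e)
    -- Here `b` is a double descent, and putting `N` after it makes it a valley: this replaces 𝑡 by
    -- 𝑞 = 𝑡′, the first term of the product rule.
    go true = begin
      𝑞 ⊛ (one ⊛ L true) ⊕ 𝑡 ⊛ S true ⊕ 𝑡 ⊛ (𝑡 ⊛ L true)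
        ≈⟨ solve 4 (λ q t l s → q :* (con 1 :* l) :+ t :* s :+ t :* (t :* l) := q :* l :+ t :* (s :+ t :* l))
             (λ _ → refl) 𝑞 𝑡 (L true) (S true) ⟩
      𝑞 ⊛ L true ⊕ 𝑡 ⊛ (S true ⊕ 𝑡 ⊛ L true)
        ≈⟨ ⟦x⟧.+-cong (⟦x⟧.*-congʳ {L true} (⟦x⟧.sym D-𝑡)) (⟦x⟧.*-congˡ {𝑡} (∑suffix-descent w c<N w<N)) ⟩
      D 𝑡 ⊛ L true ⊕ 𝑡 ⊛ D (L true)
        ≈⟨ D-⊛ 𝑡 (L true) ⟨
      D (𝑡 ⊛ L true) ∎
    -- Here `b` is a valley, and putting `N` after it makes `c` entered by a descent: this gives the
    -- `L true` that the ascent equation requires. The surplus 𝑠 · 𝑞 of that equation joins 𝑡 · 𝑞 to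
    -- form 𝑞′.
    go false = begin
      𝑞 ⊛ (one ⊛ L true) ⊕ 𝑞 ⊛ S false ⊕ 𝑡 ⊛ (𝑞 ⊛ L false)
        ≈⟨ solve 5 (λ q t l s m → q :* (con 1 :* l) :+ q :* s :+ t :* (q :* m) := q :* (s :+ l) :+ t :* (q :* m))
             (λ _ → refl) 𝑞 𝑡 (L true) (S false) (L false) ⟩
      𝑞 ⊛ (S false ⊕ L true) ⊕ 𝑡 ⊛ (𝑞 ⊛ L false)
        ≈⟨ ⟦x⟧.+-congʳ {𝑡 ⊛ (𝑞 ⊛ L false)} (⟦x⟧.*-congˡ {𝑞} (∑suffix-ascent w c<N w<N)) ⟩
      𝑞 ⊛ (D (L false) ⊕ 𝑠 ⊛ L false) ⊕ 𝑡 ⊛ (𝑞 ⊛ L false)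
        ≈⟨ solve 5 (λ q t s d m → q :* (d :+ s :* m) :+ t :* (q :* m) := (s :+ t) :* q :* m :+ q :* d)
             (λ _ → refl) 𝑞 𝑡 𝑠 (D (L false)) (L false) ⟩
      (𝑠 ⊕ 𝑡) ⊛ 𝑞 ⊛ L false ⊕ 𝑞 ⊛ D (L false)
        ≈⟨ ⟦x⟧.+-congʳ {𝑞 ⊛ D (L false)} (⟦x⟧.*-congʳ {L false} D-𝑞) ⟨
      D 𝑞 ⊛ L false ⊕ 𝑞 ⊛ D (L false)
        ≈⟨ D-⊛ 𝑞 (L false) ⟨
      D (𝑞 ⊛ L false) ∎

  ∑suffix-ascent : ∀ {N b} w → b < N → All (_< N) w →
    ∑suffix N false b w ⊕ suffixWeight true b w ≈ D (suffixWeight false b w) ⊕ 𝑠 ⊛ suffixWeight false b w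
  ∑suffix-ascent {N} {b} [] b<N [] rewrite dec-false (N ℕ.<? b) (ℕ.<-asym b<N) = ⟦x⟧.trans
    (solve 2 (λ q s → s :* s :+ con 0 :+ q := q :+ s :* s) (λ _ → refl) 𝑞 𝑠)
    (⟦x⟧.+-congʳ {𝑠 ⊛ 𝑠} (⟦x⟧.sym D-𝑠))
    where open ⟦x⟧-Solver
  ∑suffix-ascent {N} {b} (c ∷ w) b<N (c<N ∷ w<N) = ⟦x⟧.trans
    (⟦x⟧.+-congʳ {suffixWeight true b (c ∷ w)} (∑suffix-∷ false w b<N c<N)) (go (b >ᵈ c))
    where
    open ⟦x⟧-Solver
    open SetoidReasoning ⟦x⟧.setoid
    L : Bool → PowerSeries
    L e = suffixWeight e c w
    S : Bool → PowerSeries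
    S e = ∑suffix N e c w
    go : ∀ e → 𝑠 ⊛ (one ⊛ L true) ⊕ ω false e ⊛ S e ⊕ ω true e ⊛ L e ≈
               D (ω false e ⊛ L e) ⊕ 𝑠 ⊛ (ω false e ⊛ L e)
    -- Here `b` is a peak of constant weight; the added term `𝑡 ⊛ L true` is the one that the
    -- descent equation for `c` requires.
    go true = begin
      𝑠 ⊛ (one ⊛ L true) ⊕ one ⊛ S true ⊕ 𝑡 ⊛ L true
        ≈⟨ solve 4 (λ q t l s → q :* (con 1 :* l) :+ con 1 :* s :+ t :* l := (s :+ t :* l) :+ q :* (con 1 :* l))
             (λ _ → refl) 𝑠 𝑡 (L true) (S true) ⟩
      (S true ⊕ 𝑡 ⊛ L true) ⊕ 𝑠 ⊛ (one ⊛ L true)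
        ≈⟨ ⟦x⟧.+-congʳ {𝑠 ⊛ (one ⊛ L true)} (∑suffix-descent w c<N w<N) ⟩
      D (L true) ⊕ 𝑠 ⊛ (one ⊛ L true)
        ≈⟨ ⟦x⟧.+-congʳ {𝑠 ⊛ (one ⊛ L true)} (D-cong (⊛-identityˡ (L true))) ⟨
      D (one ⊛ L true) ⊕ 𝑠 ⊛ (one ⊛ L true) ∎
    -- Here `b` is a double ascent; the added term `𝑞 ⊛ L false` is the part 𝑠′ · `L false` of the
    -- product rule.
    go false = begin
      𝑠 ⊛ (one ⊛ L true) ⊕ 𝑠 ⊛ S false ⊕ 𝑞 ⊛ L false
        ≈⟨ solve 5 (λ q s l x m → s :* (con 1 :* l) :+ s :* x :+ q :* m := q :* m :+ s :* (x :+ l))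
             (λ _ → refl) 𝑞 𝑠 (L true) (S false) (L false) ⟩
      𝑞 ⊛ L false ⊕ 𝑠 ⊛ (S false ⊕ L true)
        ≈⟨ ⟦x⟧.+-cong (⟦x⟧.*-congʳ {L false} (⟦x⟧.sym D-𝑠)) (⟦x⟧.*-congˡ {𝑠} (∑suffix-ascent w c<N w<N)) ⟩
      D 𝑠 ⊛ L false ⊕ 𝑠 ⊛ (D (L false) ⊕ 𝑠 ⊛ L false)
        ≈⟨ solve 4 (λ d s e m → d :* m :+ s :* (e :+ s :* m) := (d :* m :+ s :* e) :+ s :* (s :* m))
             (λ _ → refl) (D 𝑠) 𝑠 (D (L false)) (L false) ⟩
      (D 𝑠 ⊛ L false ⊕ 𝑠 ⊛ D (L false)) ⊕ 𝑠 ⊛ (𝑠 ⊛ L false)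
        ≈⟨ ⟦x⟧.+-congʳ {𝑠 ⊛ (𝑠 ⊛ L false)} (D-⊛ 𝑠 (L false)) ⟨
      D (𝑠 ⊛ L false) ⊕ 𝑠 ⊛ (𝑠 ⊛ L false) ∎

-- In front of the word `N` is a double descent, while `b` is still entered by a descent. This place
-- contributes exactly the extra term of `∑suffix-descent`.
∑-insertions : ∀ {N b} w → b < N → All (_< N) w →
               ∑ weight (insertions N (b ∷ w)) ≈ D (weight (b ∷ w))
∑-insertions {N} {b} w b<N w<N = begin
  suffixWeight true N (b ∷ w) ⊕ ∑ weight (map (b ∷_) (insertions N w))
    ≡⟨ cong₂ _⊕_ (cong (λ e → ω true e ⊛ suffixWeight e b w) (dec-true (b ℕ.<? N) b<N))
                 (∑-map weight (b ∷_) (insertions N w)) ⟩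
  𝑡 ⊛ suffixWeight true b w ⊕ ∑suffix N true b w
    ≈⟨ ⟦x⟧.+-comm (𝑡 ⊛ suffixWeight true b w) (∑suffix N true b w) ⟩
  ∑suffix N true b w ⊕ 𝑡 ⊛ suffixWeight true b w
    ≈⟨ ∑suffix-descent w b<N w<N ⟩
  D (suffixWeight true b w) ∎
  where open SetoidReasoning ⟦x⟧.setoid

-- Generating permutations by insertion

[1⋯suc_] : ∀ n → [1⋯ suc n ] ≡ [1⋯ n ] ++ suc n ∷ []
[1⋯suc n ] = trans (cong (map suc) (sym (List.upTo-∷ʳ n))) (List.map-++ suc (upTo n) (n ∷ []))

∈-[1⋯]⇒< : ∀ {n a} → a ∈ [1⋯ n ] → a < suc n
∈-[1⋯]⇒< a∈ with _ , i∈ , refl ← ∈-map⁻ suc a∈ = ℕ.s<s (∈-upTo⁻ i∈)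

length-[1⋯] : ∀ n → length [1⋯ n ] ≡ n
length-[1⋯] n = trans (List.length-map suc (upTo n)) (List.length-upTo n)

∈-words⁺ : ∀ {as w} → All (_∈ as) w → w ∈ words as (length w)
∈-words⁺ []         = here refl
∈-words⁺ (a∈ ∷ w⊆) = ∈-cartesianProductWith⁺ _∷_ a∈ (∈-words⁺ w⊆)

∈-words⁻ : ∀ as m {w} → w ∈ words as m → length w ≡ m × All (_∈ as) w
∈-words⁻ as zero    (here refl) = refl , []
∈-words⁻ as (suc m) w∈
  with _ , _ , a∈ , v∈ , refl ← ∈-cartesianProductWith⁻ _∷_ as (words as m) w∈
  with len , v⊆ ← ∈-words⁻ as m v∈ = cong suc len , a∈ ∷ v⊆

words-unique : ∀ {as} m → Unique as → Unique (words as m)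
words-unique zero    as! = [] ∷ []
words-unique (suc m) as! = cartesianProductWith⁺ _∷_ List.∷-injective as! (words-unique m as!)

∈-𝔖⁺ : ∀ {n π} → length π ≡ n → All (_∈ [1⋯ n ]) π → Unique π → π ∈ 𝔖 n
∈-𝔖⁺ refl π⊆ π! = ∈-filter⁺ (unique? ℕ._≟_) (∈-words⁺ π⊆) π!

∈-𝔖⁻ : ∀ n {π} → π ∈ 𝔖 n → length π ≡ n × All (_∈ [1⋯ n ]) π × Unique π
∈-𝔖⁻ n π∈
  with π∈words , π! ← ∈-filter⁻ (unique? ℕ._≟_) {xs = words [1⋯ n ] n} π∈
  with len , π⊆ ← ∈-words⁻ [1⋯ n ] n π∈words = len , π⊆ , π!

𝔖-unique : ∀ n → Unique (𝔖 n)
𝔖-unique n = filter⁺ (unique? ℕ._≟_) (words-unique n (map⁺ ℕ.suc-injective (upTo⁺ n)))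

𝔖-letters< : ∀ n {π} → π ∈ 𝔖 n → All (_< suc n) π
𝔖-letters< n π∈ = All.map ∈-[1⋯]⇒< (proj₁ (proj₂ (∈-𝔖⁻ n π∈)))

∈-insertions⁺ : ∀ N u v → u ++ N ∷ v ∈ insertions N (u ++ v)
∈-insertions⁺ N []      []      = here refl
∈-insertions⁺ N []      (_ ∷ _) = here refl
∈-insertions⁺ N (b ∷ u) v       = there (∈-map⁺ (b ∷_) (∈-insertions⁺ N u v))

∈-insertions⇒↭ : ∀ {N} w {π} → π ∈ insertions N w → π ↭ N ∷ w
∈-insertions⇒↭ []      (here refl) = ↭.refl
∈-insertions⇒↭ (b ∷ w) (here refl) = ↭.refl
∈-insertions⇒↭ (b ∷ w) (there π∈) with _ , v∈ , refl ← ∈-map⁻ (b ∷_) π∈ =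
  ↭.trans (↭.prep b (∈-insertions⇒↭ w v∈)) (↭.swap b _ ↭.refl)

-- Recovers a word from any insertion of a letter foreign to it, which shows that different words
-- have no insertion in common.
delete : ℕ → List ℕ → List ℕ
delete N = filter (λ a → ¬? (N ℕ.≟ a))

delete-insertion : ∀ {N} w {π} → All (N ≢_) w → π ∈ insertions N w → delete N π ≡ w
delete-insertion {N} [] [] (here refl) = List.filter-reject (λ a → ¬? (N ℕ.≟ a)) (_$ refl)
delete-insertion {N} (b ∷ w) N∉ (here refl) =
  trans (List.filter-reject (λ a → ¬? (N ℕ.≟ a)) (_$ refl)) (List.filter-all (λ a → ¬? (N ℕ.≟ a)) N∉)
delete-insertion {N} (b ∷ w) (N≢b ∷ N∉) (there π∈) with _ , v∈ , refl ← ∈-map⁻ (b ∷_) π∈ =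
  trans (List.filter-accept (λ a → ¬? (N ℕ.≟ a)) N≢b) (cong (b ∷_) (delete-insertion w N∉ v∈))

insertions-unique : ∀ {N} w → All (N ≢_) w → Unique (insertions N w)
insertions-unique []      []          = [] ∷ []
insertions-unique (b ∷ w) (N≢b ∷ N∉) =
  All.tabulate (λ {_} π∈ eq → different π∈ eq) ∷ map⁺ List.∷-injectiveʳ (insertions-unique w N∉)
  where
  different : ∀ {π} → π ∈ map (b ∷_) (insertions _ w) → _ ∷ b ∷ w ≢ π
  different π∈ eq with _ , _ , refl ← ∈-map⁻ (b ∷_) π∈ = N≢b (List.∷-injectiveˡ eq)

-- Since `g` reads off from a member of `f x` which `x` it came from, the lists `f x` are pairwise
-- disjoint.
concatMap-unique : ∀ {A B : Set} (f : A → List B) (g : B → A) xs →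
  (∀ {x} → x ∈ xs → Unique (f x)) →
  (∀ {x y} → x ∈ xs → y ∈ f x → g y ≡ x) →
  Unique xs → Unique (concatMap f xs)
concatMap-unique f g []       f! g∘f []         = []
concatMap-unique f g (x ∷ xs) f! g∘f (x∉ ∷ xs!) =
  ++⁺ (f! (here refl)) (concatMap-unique f g xs (f! ∘ there) (g∘f ∘ there) xs!) disjoint
  where
  disjoint : Disjoint (f x) (concatMap f xs)
  disjoint (y∈fx , y∈) with x′ , x′∈ , y∈fx′ ← find (∈-concatMap⁻ f {xs = xs} y∈) =
    All.lookup x∉ x′∈ (trans (sym (g∘f (here refl) y∈fx)) (g∘f (there x′∈) y∈fx′))

-- Pigeonhole principle: remove the first element of `xs` from both lists and recurse.
Unique∧⊆⇒length≤ : ∀ {A : Set} {xs ys : List A} → Unique xs → All (_∈ ys) xs → length xs ≤ length ys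
Unique∧⊆⇒length≤ []         []        = ℕ.z≤n
Unique∧⊆⇒length≤ {xs = x ∷ xs} (x∉ ∷ xs!) (x∈ ∷ xs⊆) with u , v , refl ← ∈-∃++ x∈ =
  subst (suc (length xs) ≤_) (sym (↭-length (shift x u v)))
    (ℕ.s≤s (Unique∧⊆⇒length≤ xs! (All.tabulate λ {z} z∈ → avoid (All.lookup x∉ z∈) (All.lookup xs⊆ z∈))))
  where
  avoid : ∀ {z} → x ≢ z → z ∈ u ++ x ∷ v → z ∈ u ++ v
  avoid x≢z z∈ with ∈-resp-↭ (shift x u v) z∈
  ... | here z≡x = contradiction (sym z≡x) x≢z
  ... | there z∈ = z∈

Unique-resp-↭ : ∀ {xs ys : List ℕ} → xs ↭ ys → Unique xs → Unique ys
Unique-resp-↭ p = Permutationₛ.Unique-resp-↭ (setoid ℕ) (↭⇒↭ₛ p)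

[1⋯]-weaken : ∀ {n a} → a ∈ [1⋯ n ] → a ∈ [1⋯ suc n ]
[1⋯]-weaken {n} {a} a∈ = subst (a ∈_) (sym [1⋯suc n ]) (∈-++⁺ˡ a∈)

[1⋯]-strengthen : ∀ {n a} → suc n ≢ a → a ∈ [1⋯ suc n ] → a ∈ [1⋯ n ]
[1⋯]-strengthen {n} {a} a≢ a∈ with ∈-++⁻ [1⋯ n ] (subst (a ∈_) [1⋯suc n ] a∈)
... | inj₁ a∈         = a∈
... | inj₂ (here a≡) = contradiction (sym a≡) a≢

-- Otherwise n + 1 distinct letters would fit into `[1⋯ n ]`.
max∈𝔖 : ∀ n {π} → π ∈ 𝔖 (suc n) → suc n ∈ π
max∈𝔖 n {π} π∈ with _∈?_ ℕ._≟_ (suc n) π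
... | yes N∈ = N∈
... | no  N∉ with len , π⊆ , π! ← ∈-𝔖⁻ (suc n) π∈ = contradiction
  (subst₂ _≤_ len (length-[1⋯] n) (Unique∧⊆⇒length≤ π! (All.tabulate λ {a} a∈ →
    [1⋯]-strengthen (λ { refl → N∉ a∈ }) (All.lookup π⊆ a∈))))
  (ℕ.<⇒≱ (ℕ.n<1+n n))

-- Neither list has repetitions, so it suffices to compare members: removing the maximum leads one
-- way, inserting it the other.
𝔖-suc : ∀ n → 𝔖 (suc n) ↭ concatMap (insertions (suc n)) (𝔖 n)
𝔖-suc n = ∼bag⇒↭ (unique∧set⇒bag (𝔖-unique (suc n))
  (concatMap-unique (insertions (suc n)) (delete (suc n)) (𝔖 n)
    (λ {w} w∈ → insertions-unique w (N∉ w∈))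
    (λ {w} w∈ → delete-insertion w (N∉ w∈))
    (𝔖-unique n))
  (mk⇔ to from))
  where
  N∉ : ∀ {w} → w ∈ 𝔖 n → All (suc n ≢_) w
  N∉ w∈ = All.map (λ a<N → ℕ.<⇒≢ a<N ∘ sym) (𝔖-letters< n w∈)
  to : ∀ {π} → π ∈ 𝔖 (suc n) → π ∈ concatMap (insertions (suc n)) (𝔖 n)
  to {π} π∈ with u , v , refl ← ∈-∃++ (max∈𝔖 n π∈)
            with len , π⊆ , π! ← ∈-𝔖⁻ (suc n) π∈
            with N∉uv ∷ uv! ← Unique-resp-↭ (shift (suc n) u v) π!
            with _ ∷ uv⊆ ← All-resp-↭ (shift (suc n) u v) π⊆ =
    ∈-concatMap⁺ (insertions (suc n)) {xs = 𝔖 n} (lose w∈ (∈-insertions⁺ (suc n) u v))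
    where
    w∈ : u ++ v ∈ 𝔖 n
    w∈ = ∈-𝔖⁺ (ℕ.suc-injective (trans (sym (↭-length (shift (suc n) u v))) len))
      (All.zipWith (λ (N≢a , a∈) → [1⋯]-strengthen N≢a a∈) (N∉uv , uv⊆)) uv!
  from : ∀ {π} → π ∈ concatMap (insertions (suc n)) (𝔖 n) → π ∈ 𝔖 (suc n)
  from π∈ with w , w∈ , π∈w ← find (∈-concatMap⁻ (insertions (suc n)) {xs = 𝔖 n} π∈)
          with len , w⊆ , w! ← ∈-𝔖⁻ n w∈ =
    ∈-𝔖⁺ (trans (↭-length p) (cong suc len))
      (All-resp-↭ (↭.↭-sym p) (N∈ ∷ All.map [1⋯]-weaken w⊆))
      (Unique-resp-↭ (↭.↭-sym p) (N∉ w∈ ∷ w!))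
    where
    p = ∈-insertions⇒↭ w π∈w
    N∈ : suc n ∈ [1⋯ suc n ]
    N∈ = subst (suc n ∈_) (sym [1⋯suc n ]) (∈-++⁺ʳ [1⋯ n ] (here refl))

-- Evaluation at x = 0

D^ : ℕ → PowerSeries → PowerSeries
D^ zero    f = f
D^ (suc n) f = D (D^ n f)

-- The induction starts with the one-letter word, a valley of weight 𝑞 = tan′. The empty word cannot
-- serve: its weight `one` has derivative `𝟘`.
∑-𝔖 : ∀ n → ∑ weight (𝔖 (suc n)) ≈ D^ (suc n) tan
∑-𝔖 zero    = ⟦x⟧.trans (⟦x⟧.+-identityʳ 𝑞) (⟦x⟧.sym D-tan)
∑-𝔖 (suc n) = begin
  ∑ weight (𝔖 (suc N))                                ≈⟨ ∑-↭ weight (𝔖-suc N) ⟩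
  ∑ weight (concatMap (insertions (suc N)) (𝔖 N))     ≈⟨ ∑-concatMap weight (insertions (suc N)) (𝔖 N) ⟩
  ∑ (∑ weight ∘ insertions (suc N)) (𝔖 N)             ≈⟨ ∑-cong-∈ (𝔖 N) insert ⟩
  ∑ (D ∘ weight) (𝔖 N)                                ≈⟨ D-∑ weight (𝔖 N) ⟨
  D (∑ weight (𝔖 N))                                  ≈⟨ D-cong (∑-𝔖 n) ⟩
  D (D^ N tan)                                        ∎
  where
  open SetoidReasoning ⟦x⟧.setoid
  N : ℕ
  N = suc n
  insert : ∀ {π} → π ∈ 𝔖 N → ∑ weight (insertions (suc N) π) ≈ D (weight π)
  insert {[]}    π∈ = contradiction (proj₁ (∈-𝔖⁻ N π∈)) λ ()
  insert {b ∷ w} π∈ with b<N ∷ w<N ← 𝔖-letters< N π∈ = ∑-insertions w b<N w<N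

D^-D : ∀ n f → D^ n (D f) ≡ D (D^ n f)
D^-D zero    f = refl
D^-D (suc n) f = cong D (D^-D n f)

-- Taylor's formula. The innermost derivative is peeled off, so the hypothesis is used for `D f`.
D^-at-0 : ∀ n f → D^ n f 0 ≡ ι (n !) ℚ.* f n
D^-at-0 zero    f = sym (ℚ.*-identityˡ (f 0))
D^-at-0 (suc n) f = begin
  D (D^ n f) 0                              ≡⟨ cong (_$ 0) (D^-D n f) ⟨
  D^ n (D f) 0                              ≡⟨ D^-at-0 n (D f) ⟩
  ι (n !) ℚ.* (ι (suc n) ℚ.* f (suc n))     ≡⟨ ℚ.*-assoc (ι (n !)) (ι (suc n)) (f (suc n)) ⟨
  ι (n !) ℚ.* ι (suc n) ℚ.* f (suc n)       ≡⟨ cong (ℚ._* f (suc n)) (/-scale (+ (n !)) (+ suc n) 1) ⟩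
  ((+ (n !) ℤ.* + suc n) / 1) ℚ.* f (suc n) ≡⟨ cong (λ i → (i / 1) ℚ.* f (suc n)) (trans (sym (ℤ.pos-* (n !) (suc n))) (cong +_ (ℕ.*-comm (n !) (suc n)))) ⟩
  ι (suc n !) ℚ.* f (suc n)                 ∎
  where open ≡-Reasoning

-- At x = 0 the weight `ω δ e` is -1 for a double descent and 1 for every other letter.
sign-∷ : ∀ δ e d → (-1ℤ ℤ.^ ((if δ ∧ e then 1 else 0) ℕ.+ d)) / 1 ≡ ω δ e 0 ℚ.* ((-1ℤ ℤ.^ d) / 1)
sign-∷ true  true  d = sym (/-scale -1ℤ (-1ℤ ℤ.^ d) 1)
sign-∷ true  false d = sym (ℚ.*-identityˡ ((-1ℤ ℤ.^ d) / 1))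
sign-∷ false true  d = sym (ℚ.*-identityˡ ((-1ℤ ℤ.^ d) / 1))
sign-∷ false false d = sym (ℚ.*-identityˡ ((-1ℤ ℤ.^ d) / 1))

-- The predecessor `a` of `b` may be ∞, so the same induction covers the first letter.
suffixWeight-at-0 : ∀ a b w →
  (-1ℤ ℤ.^ descentTriples (a ∷ [ b ] ∷ map [_] w ++ ⊤⁺ ∷ [])) / 1 ≡ suffixWeight (does ([ b ] <⁺? a)) b w 0
suffixWeight-at-0 a b []      = trans (sign-∷ (does ([ b ] <⁺? a)) false 0) (ℚ.*-identityʳ (ω (does ([ b ] <⁺? a)) false 0))
suffixWeight-at-0 a b (c ∷ w) = begin
  (-1ℤ ℤ.^ ((if δ ∧ (b >ᵈ c) then 1 else 0) ℕ.+ d)) / 1     ≡⟨ sign-∷ δ (b >ᵈ c) d ⟩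
  ω δ (b >ᵈ c) 0 ℚ.* ((-1ℤ ℤ.^ d) / 1)                      ≡⟨ cong (ω δ (b >ᵈ c) 0 ℚ.*_) (suffixWeight-at-0 [ b ] c w) ⟩
  ω δ (b >ᵈ c) 0 ℚ.* suffixWeight (b >ᵈ c) c w 0            ≡⟨ ℚ.+-identityʳ (ω δ (b >ᵈ c) 0 ℚ.* suffixWeight (b >ᵈ c) c w 0) ⟨
  suffixWeight δ b (c ∷ w) 0                                ∎
  where
  open ≡-Reasoning
  δ : Bool
  δ = does ([ b ] <⁺? a)
  d : ℕ
  d = descentTriples ([ b ] ∷ [ c ] ∷ map [_] w ++ ⊤⁺ ∷ [])

weight-at-0 : ∀ π → (-1ℤ ℤ.^ ddes π) / 1 ≡ weight π 0
weight-at-0 []      = refl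
weight-at-0 (b ∷ w) = suffixWeight-at-0 ⊤⁺ b w

∑-weight-at-0 : ∀ πs → foldr ℤ._+_ 0ℤ (map (λ π → -1ℤ ℤ.^ ddes π) πs) / 1 ≡ ∑ weight πs 0
∑-weight-at-0 []       = refl
∑-weight-at-0 (π ∷ πs) = trans
  (sym (/1-homo-+ (-1ℤ ℤ.^ ddes π) (foldr ℤ._+_ 0ℤ (map (λ π → -1ℤ ℤ.^ ddes π) πs))))
  (cong₂ ℚ._+_ (weight-at-0 π) (∑-weight-at-0 πs))

-- Values at -1 and the generating function

P≡n!*tan : ∀ n → 1 ≤ n → P n -1ℤ / 1 ≡ ι (n !) ℚ.* tan n
P≡n!*tan (suc n) _ = begin
  P (suc n) -1ℤ / 1              ≡⟨ ∑-weight-at-0 (𝔖 (suc n)) ⟩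
  ∑ weight (𝔖 (suc n)) 0         ≡⟨ ∑-𝔖 n 0 ⟩
  D^ (suc n) tan 0               ≡⟨ D^-at-0 (suc n) tan ⟩
  ι (suc n !) ℚ.* tan (suc n)    ∎
  where open ≡-Reasoning

/1-injective : ∀ {i j} → i / 1 ≡ j / 1 → i ≡ j
/1-injective {i} {j} eq with *≡* i*1≡j*1 ← ℚ.fromℚᵘ-injective {mkℚᵘ i 0} {mkℚᵘ j 0} eq =
  ℤ.*-cancelʳ-≡ i j 1ℤ i*1≡j*1

P-odd : ∀ n → 1 ≤ n → parity n ≡ 1ℙ → P n -1ℤ / 1 ≡ E n
P-odd n 1≤n odd = begin
  P n -1ℤ / 1                     ≡⟨ P≡n!*tan n 1≤n ⟩
  ι (n !) ℚ.* tan n               ≡⟨ cong (ι (n !) ℚ.*_) (ℚ.+-identityˡ (tan n)) ⟨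
  ι (n !) ℚ.* (0ℚ ℚ.+ tan n)      ≡⟨ cong (λ x → ι (n !) ℚ.* (x ℚ.+ tan n)) (sec-odd n odd) ⟨
  E n                             ∎
  where open ≡-Reasoning

P-even : ∀ n → 1 ≤ n → parity n ≡ 0ℙ → P n -1ℤ ≡ 0ℤ
P-even n 1≤n even = /1-injective $ begin
  P n -1ℤ / 1           ≡⟨ P≡n!*tan n 1≤n ⟩
  ι (n !) ℚ.* tan n     ≡⟨ cong (ι (n !) ℚ.*_) (tan-even n even) ⟩
  ι (n !) ℚ.* 0ℚ        ≡⟨ ℚ.*-zeroʳ (ι (n !)) ⟩
  0ℤ / 1                ∎
  where open ≡-Reasoning

Pˢ≈tan : Pˢ -1ℤ ≈ tan
-- Both constant terms are 0, as the sum over permutations starts at n = 1.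
Pˢ≈tan zero      = refl
Pˢ≈tan m@(suc n) = ι-cancelˡ (m !) {{m !≢0}} $ begin
  ι (m !) ℚ.* (P m -1ℤ / m !) {{m !≢0}}          ≡⟨ /-scale (+ (m !)) (P m -1ℤ) (m !) {{m !≢0}} ⟩
  -- The denominator is written as `m ! ℕ.* 1` so that cancelling `m !` leaves the denominator 1.
  ((+ (m !) ℤ.* P m -1ℤ) / m !) {{m !≢0}}        ≡⟨ ℚ./-cong {+ (m !) ℤ.* P m -1ℤ} {{m !≢0}} {{m!*1≢0}} refl (sym (ℕ.*-identityʳ (m !))) ⟩
  ((+ (m !) ℤ.* P m -1ℤ) / (m ! ℕ.* 1)) {{m!*1≢0}} ≡⟨ /-cancelˡ (m !) (P m -1ℤ) 1 {{_}} {{m!*1≢0}} ⟩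
  P m -1ℤ / 1                                    ≡⟨ P≡n!*tan m (ℕ.s≤s ℕ.z≤n) ⟩
  ι (m !) ℚ.* tan m                              ∎
  where
  open ≡-Reasoning
  m!*1≢0 : ℕ.NonZero (m ! ℕ.* 1)
  m!*1≢0 = ℕ.m*n≢0 (m !) 1 {{m !≢0}}

theorem6 : ((n : ℕ) → 1 ≤ n →
    (parity n ≡ 1ℙ → P n -1ℤ / 1 ≡ E n) ×
    (parity n ≡ 0ℙ → P n -1ℤ ≡ 0ℤ))
    × (Pˢ -1ℤ ≈ tan)
theorem6 = (λ n 1≤n → P-odd n 1≤n , P-even n 1≤n) , Pˢ≈tan
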